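{- For every $k\ge 3$ and every point $(x_1,\ldots,x_k)$ of the $k$-simplex, $$d_k(x_1,\ldots,x_k)\le\begin{cases}C_k(x_1,x_2) & \text{if } x_i\le 6/11 \text{ for all } i>2,\\ C_3(x_1,x_2) & \text{if there exists } i>2 \text{ with } x_i\ge 6/11.\end{cases}$$
   Context: The $k$-simplex is $\{x\in\mathbb{R}^k: x\ge 0,\ \sum_i x_i=1\}$. Let $F(z)=\min\{(11/6)z,1\}$ for $z\in[0,1]$, and let $F'(z)=11/6$ for $z\in[0,6/11]$ and $F'(z)=0$ otherwise. For a point $(x_1,\dots,x_k)$ of the $k$-simplex define $$d_k(x_1,\ldots,x_k)=\frac{1}{k!}\sum_{\sigma}\Big(F'(x_1)\prod_{i:\sigma(i)<\sigma(1)}[1-F(x_i)]+F'(x_2)\prod_{i:\sigma(i)<\sigma(2)}[1-F(x_i)]\Big),$$ the sum being over all permutations $\sigma$ of $\{1,\dots,k\}$. For $k\ge 3$ and $x_1,x_2\ge0$ with $x_1+x_2\le1$ define $C_k(x_1,x_2)=d_k(x_1,x_2,c,\ldots,c)$ where $c=(1-x_1-x_2)/(k-2)$. -}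

module Defs where

open import Algebra.Bundles using (CommutativeRing)
open import Algebra.Structures using (IsCommutativeRing)
import Algebra.Definitions.RawMonoid as RawMonoidDefs
import Algebra.Construct.NaturalChoice.Min as Min
import Algebra.Properties.Ring as RingProperties
open import Data.Bool.Base using (if_then_else_)
open import Data.Fin.Base using (Fin; punchIn)
open import Data.Fin.Patterns using (0F; 1F)
open import Data.Fin.Permutation using (Permutation′; _⟨$⟩ʳ_; insert; remove; insert-remove)
  renaming (_≈_ to _≈ₚ_; id to idₚ)
open import Data.Fin.Properties using (_<?_; _≟_)
open import Data.List.Base using (List; []; _∷_; map; filter; foldr; allFin; cartesianProductWith; length)
open import Data.List.Membership.Propositional using (_∈_)
open import Data.List.Membership.Propositional.Properties using (∈-allFin; ∈-cartesianProductWith⁺)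
open import Data.List.Properties using (length-++; length-map; length-tabulate)
open import Data.List.Relation.Unary.Any using (here)
open import Data.Nat.Base as ℕ using (ℕ; zero; suc; 2+; NonZero; _!)
open import Data.Nat.Properties using (_!≢0)
open import Data.Product.Base using (∃; _×_; _,_; proj₁)
open import Data.Sum.Base using (inj₁; inj₂)
open import Data.Vec.Functional as Vector using (Vector)
open import Function.Base using (id)
open import Level using (_⊔_) renaming (suc to lsuc)
open import Relation.Binary.Bundles using (DecTotalOrder)
open import Relation.Binary.Core using (Rel)
open import Relation.Binary.PropositionalEquality as ≡ using (_≡_)
open import Relation.Binary.Structures using (IsDecTotalOrder)
open import Relation.Nullary using (¬_; does; yes; no)

-- The role of ℝ is played by an arbitrary ordered field.  Decidability of
-- the order is what makes the piecewise definition of F′ below meaningful;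
-- classically it always holds, so ℝ is an instance.
record OrderedField c ℓ₁ ℓ₂ : Set (lsuc (c ⊔ ℓ₁ ⊔ ℓ₂)) where
  infix  8 -_
  infixl 7 _*_
  infixl 6 _+_
  infix  4 _≈_ _≤_
  field
    Carrier           : Set c
    _≈_               : Rel Carrier ℓ₁
    _≤_               : Rel Carrier ℓ₂
    _+_ _*_           : Carrier → Carrier → Carrier
    -_                : Carrier → Carrier
    0# 1#             : Carrier
    isCommutativeRing : IsCommutativeRing _≈_ _+_ _*_ -_ 0# 1#
    isDecTotalOrder   : IsDecTotalOrder _≈_ _≤_
    0≉1               : ¬ (0# ≈ 1#)
    inverse           : ∀ x → ¬ (x ≈ 0#) → ∃ λ y → x * y ≈ 1#
    +-monoˡ-≤         : ∀ z {x y} → x ≤ y → x + z ≤ y + z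
    *-nonNeg          : ∀ {x y} → 0# ≤ x → 0# ≤ y → 0# ≤ x * y

  commutativeRing : CommutativeRing c ℓ₁
  commutativeRing = record { isCommutativeRing = isCommutativeRing }

  decTotalOrder : DecTotalOrder c ℓ₁ ℓ₂
  decTotalOrder = record { isDecTotalOrder = isDecTotalOrder }

  open CommutativeRing commutativeRing public using (_-_; ring)
  open DecTotalOrder decTotalOrder public using (_≤?_; totalOrder)

  open RawMonoidDefs (CommutativeRing.+-rawMonoid commutativeRing) public
    using (sum) renaming (_×_ to _·_)

  fromℕ : ℕ → Carrier
  fromℕ n = n · 1#

  private
    module R = CommutativeRing commutativeRing
    module O = DecTotalOrder decTotalOrder
    open RingProperties ring using (-‿distribˡ-*; -‿distribʳ-*; -‿involutive)

  0≤1 : 0# ≤ 1#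
  0≤1 with O.total 0# 1#
  ... | inj₁ 0≤1 = 0≤1
  ... | inj₂ 1≤0 = O.≤-respʳ-≈ [-1]²≈1 (*-nonNeg 0≤-1 0≤-1)
    where
    0≤-1 : 0# ≤ - 1#
    0≤-1 = O.≤-respʳ-≈ (R.+-identityˡ _)
             (O.≤-respˡ-≈ (R.-‿inverseʳ 1#) (+-monoˡ-≤ (- 1#) 1≤0))

    [-1]²≈1 : - 1# * - 1# ≈ 1#
    [-1]²≈1 = R.trans (R.sym (-‿distribˡ-* 1# (- 1#)))
                (R.trans (R.-‿cong (R.*-identityˡ (- 1#))) (-‿involutive 1#))

  1≤fromℕ[1+n] : ∀ n → 1# ≤ fromℕ (suc n)
  0≤fromℕ      : ∀ n → 0# ≤ fromℕ n

  1≤fromℕ[1+n] n = O.≤-respˡ-≈ (R.+-identityˡ 1#)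
    (O.≤-respʳ-≈ (R.+-comm (fromℕ n) 1#) (+-monoˡ-≤ 1# (0≤fromℕ n)))

  0≤fromℕ zero    = O.refl
  0≤fromℕ (suc n) = O.trans 0≤1 (1≤fromℕ[1+n] n)

  fromℕ≉0 : ∀ n .{{_ : NonZero n}} → ¬ (fromℕ n ≈ 0#)
  fromℕ≉0 (suc n) eq = 0≉1 (O.antisym 0≤1 (O.≤-respʳ-≈ eq (1≤fromℕ[1+n] n)))

  infixl 7 _/_
  _/_ : Carrier → (n : ℕ) .{{_ : NonZero n}} → Carrier
  x / n = x * proj₁ (inverse (fromℕ n) (fromℕ≉0 n))

-- Every permutation of Fin n, each listed once: a permutation of
-- Fin (suc n) is given by the image j of 0 and a permutation of the rest.
permutations : ∀ n → List (Permutation′ n)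
permutations zero    = idₚ ∷ []
permutations (suc n) = cartesianProductWith (insert 0F) (allFin (suc n)) (permutations n)

-- The next two facts together say that the enumeration is exhaustive and
-- without repetition.
permutations-length : ∀ n → length (permutations n) ≡ n !
permutations-length zero    = ≡.refl
permutations-length (suc n) = ≡.trans
  (length-product (allFin (suc n)))
  (≡.cong₂ ℕ._*_ (length-tabulate {n = suc n} id) (permutations-length n))
  where
  length-product : ∀ js → length (cartesianProductWith (insert 0F) js (permutations n))
                          ≡ length js ℕ.* length (permutations n)
  length-product []       = ≡.refl
  length-product (j ∷ js) = ≡.trans (length-++ (map (insert 0F j) (permutations n)))
    (≡.cong₂ ℕ._+_ (length-map (insert 0F j) (permutations n)) (length-product js))

permutations-complete : ∀ {n} (π : Permutation′ n) → ∃ λ ρ → ρ ∈ permutations n × ρ ≈ₚ π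
permutations-complete {zero}  π = idₚ , here ≡.refl , λ ()
permutations-complete {suc n} π with permutations-complete (remove 0F π)
... | ρ , ρ∈ , ρ≈ =
  insert 0F j ρ ,
  ∈-cartesianProductWith⁺ (insert 0F) (∈-allFin j) ρ∈ ,
  λ i → ≡.trans (insert-cong i) (insert-remove 0F π i)
  where
  j : Fin (suc n)
  j = π ⟨$⟩ʳ 0F

  insert-cong : insert 0F j ρ ≈ₚ insert 0F j (remove 0F π)
  insert-cong i with 0F ≟ i
  ... | yes _ = ≡.refl
  ... | no  _ = ≡.cong (punchIn j) (ρ≈ _)

module Density {c ℓ₁ ℓ₂} (K : OrderedField c ℓ₁ ℓ₂) where
  open OrderedField K
  open Min totalOrder using (_⊓_)

  6/11 11/6 : Carrier
  6/11 = fromℕ 6 / 11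
  11/6 = fromℕ 11 / 6

  InSimplex : ∀ {k} → Vector Carrier k → Set (ℓ₁ ⊔ ℓ₂)
  InSimplex x = (∀ i → 0# ≤ x i) × sum x ≈ 1#

  -- F and F′ are only of interest on [0,1]; outside it their values are
  -- those of the same formulas.
  F : Carrier → Carrier
  F z = (11/6 * z) ⊓ 1#

  F′ : Carrier → Carrier
  F′ z = if does (z ≤? 6/11) then 11/6 else 0#

  Σ-list Π-list : List Carrier → Carrier
  Σ-list = foldr _+_ 0#
  Π-list = foldr _*_ 1#

  -- F′(xⱼ) ∏_{i : σ(i) < σ(j)} (1 - F(xᵢ))
  term : ∀ {k} → Vector Carrier k → Permutation′ k → Fin k → Carrier
  term {k} x σ j =
    F′ (x j) * Π-list (map (λ i → 1# - F (x i))
                           (filter (λ i → (σ ⟨$⟩ʳ i) <? (σ ⟨$⟩ʳ j)) (allFin k)))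

  -- d_k for k = 2 + m; the first two coordinates are x 0F and x 1F.
  d : ∀ {m} → Vector Carrier (2+ m) → Carrier
  d {m} x =
    (Σ-list (map (λ σ → term x σ 0F + term x σ 1F) (permutations (2+ m))) / (2+ m !))
      {{2+ m !≢0}}

  -- C[2+ m ] is C_k for k = 2 + m, so that k - 2 = m and k ≥ 3 reads m ≠ 0.
  C[2+_] : ∀ m .{{_ : NonZero m}} → Carrier → Carrier → Carrier
  C[2+ m ] x₁ x₂ =
    d (x₁ Vector.∷ x₂ Vector.∷ Vector.replicate m ((1# - x₁ - x₂) / m))

{-# OPTIONS --safe #-}

-- Put yᵢ = 1 - F(xᵢ) ∈ [0,1].  Summing over the positions of the first two
-- coordinates, k! d_k(x) = Σ_{p+q=k-2} ((p+1) α + (q+1) β) W(p,q), where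
-- α = F′(x₁) y₂ + F′(x₂) y₁ and β = F′(x₁) + F′(x₂) are nonnegative and W(p,q)
-- is the sum, over all arrangements of the k-2 other indices, of the product
-- of the yᵢ of the first p of them, that is p! q! e_p(y).  So it suffices to
-- bound W pointwise.  If all other xᵢ ≤ 6/11, then F is linear at them and
-- Maclaurin's inequality bounds W by its value at the mean.  If some other
-- xᵢ ≥ 6/11, then its yᵢ vanishes, so W(p,q) is at most its value (k-3)! q at
-- (0,1,…,1), which amounts to removing all the other coordinates but xᵢ.
module Submission where

open import Defs
open import Algebra.Bundles using (CommutativeRing)
import Algebra.Construct.NaturalChoice.Min as Min
import Algebra.Properties.CommutativeMonoid.Sum as CommutativeMonoidSum
import Algebra.Properties.Ring as RingProperties
import Algebra.Properties.Semiring.Exp as SemiringExp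
import Algebra.Properties.Semiring.Mult as SemiringMult
import Algebra.Properties.Semiring.Sum as SemiringSum
import Algebra.Solver.Ring.NaturalCoefficients.Default as SemiringSolver
open import Data.Bool.Base using (Bool; T; true; false; if_then_else_)
open import Data.Fin.Base using (Fin; zero; suc; toℕ; punchIn; _↑ʳ_)
open import Data.Fin.Patterns using (0F; 1F)
open import Data.Fin.Permutation using (Permutation′; _⟨$⟩ʳ_; insert; insert-punchIn)
open import Data.Fin.Properties using (_<?_; toℕ<n; toℕ≤pred[n])
open import Data.List.Base using ([]; _∷_; _++_; map; filter; tabulate; cartesianProductWith)
open import Data.Nat.Base as ℕ using (ℕ; zero; suc; 2+; NonZero; pred; _<ᵇ_; _∸_; _!)
import Data.Nat.Properties as ℕ
open import Data.Product.Base using (∃; _×_; _,_; proj₂)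
open import Data.Sum.Base using (inj₁; inj₂)
open import Data.Vec.Functional using (Vector; tail; replicate) renaming (_∷_ to _∷ᵥ_)
open import Function.Base using (_∘_; id)
open import Relation.Binary.Bundles using (DecTotalOrder)
import Relation.Binary.Reasoning.PartialOrder as PartialOrderReasoning
open import Relation.Binary.PropositionalEquality as ≡ using (_≡_)
open import Relation.Nullary using (does)
open import Relation.Unary using (Decidable)

module _ {c ℓ₁ ℓ₂} (K : OrderedField c ℓ₁ ℓ₂) where
  open OrderedField K
  open CommutativeRing commutativeRing
    hiding (Carrier; _≈_; _+_; _*_; -_; _-_; 0#; 1#; ring; zero)
  open DecTotalOrder decTotalOrder using (poset; total; ≤-respˡ-≈; ≤-respʳ-≈)
    renaming (refl to ≤-refl; trans to ≤-trans; reflexive to ≤-reflexive)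
  open RingProperties ring
  open CommutativeMonoidSum +-commutativeMonoid using (sum-cong-≋; ∑-distrib-+; ∑-comm)
  open SemiringSum semiring using (*-distribˡ-sum; *-distribʳ-sum)
  open SemiringExp semiring using (_^_)
  open SemiringMult semiring using (×1-homo-*; ×-homo-+)
  open SemiringSolver commutativeSemiring using (solve; _:=_; _:+_; _:*_; con; Polynomial)
  open PartialOrderReasoning poset

  -- con n stands for an optimised multiple of 1#; lit n matches fromℕ n
  -- definitionally.
  lit : ∀ {k} → ℕ → Polynomial k
  lit zero    = con 0
  lit (suc n) = con 1 :+ lit n

  -- Ordered fields

  +-monoʳ-≤ : ∀ z {x y} → x ≤ y → z + x ≤ z + y
  +-monoʳ-≤ z {x} {y} x≤y = begin
    z + x ≈⟨ +-comm z x ⟩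
    x + z ≤⟨ +-monoˡ-≤ z x≤y ⟩
    y + z ≈⟨ +-comm y z ⟩
    z + y ∎

  +-mono-≤ : ∀ {x y u v} → x ≤ y → u ≤ v → x + u ≤ y + v
  +-mono-≤ {y = y} {u} x≤y u≤v = ≤-trans (+-monoˡ-≤ u x≤y) (+-monoʳ-≤ y u≤v)

  x+y-y≈x : ∀ x y → (x + y) - y ≈ x
  x+y-y≈x x y = trans (+-assoc x y (- y)) (trans (+-congˡ (-‿inverseʳ y)) (+-identityʳ x))

  x-y+y≈x : ∀ x y → (x - y) + y ≈ x
  x-y+y≈x x y = trans (+-assoc x (- y) y) (trans (+-congˡ (-‿inverseˡ y)) (+-identityʳ x))

  +-cancelʳ-≤ : ∀ z {x y} → x + z ≤ y + z → x ≤ y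
  +-cancelʳ-≤ z {x} {y} x+z≤y+z = begin
    x           ≈⟨ x+y-y≈x x z ⟨
    (x + z) - z ≤⟨ +-monoˡ-≤ (- z) x+z≤y+z ⟩
    (y + z) - z ≈⟨ x+y-y≈x y z ⟩
    y           ∎

  x≤y⇒0≤y-x : ∀ {x y} → x ≤ y → 0# ≤ y - x
  x≤y⇒0≤y-x {x} x≤y = ≤-respˡ-≈ (-‿inverseʳ x) (+-monoˡ-≤ (- x) x≤y)

  neg-anti-≤ : ∀ {x y} → x ≤ y → - y ≤ - x
  neg-anti-≤ {x} {y} x≤y = +-cancelʳ-≤ (x + y) (begin
    - y + (x + y) ≈⟨ +-congˡ (+-comm x y) ⟩
    - y + (y + x) ≈⟨ \\-leftDividesʳ y x ⟩
    x             ≤⟨ x≤y ⟩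
    y             ≈⟨ \\-leftDividesʳ x y ⟨
    - x + (x + y) ∎)

  +-nonNeg : ∀ {x y} → 0# ≤ x → 0# ≤ y → 0# ≤ x + y
  +-nonNeg 0≤x 0≤y = ≤-respˡ-≈ (+-identityˡ 0#) (+-mono-≤ 0≤x 0≤y)

  x≤x+y : ∀ {x y} → 0# ≤ y → x ≤ x + y
  x≤x+y {x} 0≤y = ≤-respˡ-≈ (+-identityʳ x) (+-monoʳ-≤ x 0≤y)

  *-monoˡ-≤ : ∀ {x y z} → 0# ≤ z → x ≤ y → z * x ≤ z * y
  *-monoˡ-≤ {x} {y} {z} 0≤z x≤y = begin
    z * x               ≤⟨ x≤x+y (*-nonNeg 0≤z (x≤y⇒0≤y-x x≤y)) ⟩
    z * x + z * (y - x) ≈⟨ distribˡ z x (y - x) ⟨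
    z * (x + (y - x))   ≈⟨ *-congˡ (+-comm x (y - x)) ⟩
    z * ((y - x) + x)   ≈⟨ *-congˡ (x-y+y≈x y x) ⟩
    z * y               ∎

  *-monoʳ-≤ : ∀ {x y z} → 0# ≤ z → x ≤ y → x * z ≤ y * z
  *-monoʳ-≤ {x} {y} {z} 0≤z x≤y = begin
    x * z ≈⟨ *-comm x z ⟩
    z * x ≤⟨ *-monoˡ-≤ 0≤z x≤y ⟩
    z * y ≈⟨ *-comm z y ⟩
    y * z ∎

  0≤x² : ∀ x → 0# ≤ x * x
  0≤x² x with total 0# x
  ... | inj₁ 0≤x = *-nonNeg 0≤x 0≤x
  ... | inj₂ x≤0 = begin
    0#           ≤⟨ *-nonNeg 0≤-x 0≤-x ⟩
    - x * - x    ≈⟨ -‿distribˡ-* x (- x) ⟨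
    - (x * - x)  ≈⟨ -‿cong (-‿distribʳ-* x x) ⟨
    - - (x * x)  ≈⟨ -‿involutive (x * x) ⟩
    x * x        ∎
    where
    0≤-x : 0# ≤ - x
    0≤-x = ≤-respˡ-≈ -0#≈0# (neg-anti-≤ x≤0)

  2xy≤x²+y² : ∀ x y → x * y + x * y ≤ x * x + y * y
  2xy≤x²+y² x y = begin
    x * y + x * y                           ≤⟨ x≤x+y (0≤x² e) ⟩
    x * y + x * y + e * e                   ≈⟨ +-congʳ (+-cong (*-congʳ x≈e+y) (*-congʳ x≈e+y)) ⟩
    (e + y) * y + (e + y) * y + e * e       ≈⟨ solve 2 (λ e y →
      (e :+ y) :* y :+ (e :+ y) :* y :+ e :* e := (e :+ y) :* (e :+ y) :+ y :* y) refl e y ⟩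
    (e + y) * (e + y) + y * y               ≈⟨ +-congʳ (*-cong x≈e+y x≈e+y) ⟨
    x * x + y * y                           ∎
    where
    e : Carrier
    e = x - y
    x≈e+y : x ≈ e + y
    x≈e+y = sym (x-y+y≈x x y)

  ^-nonNeg : ∀ {x} n → 0# ≤ x → 0# ≤ x ^ n
  ^-nonNeg zero    0≤x = 0≤1
  ^-nonNeg (suc n) 0≤x = *-nonNeg 0≤x (^-nonNeg n 0≤x)

  young : ∀ p {a b} → 0# ≤ a → 0# ≤ b →
          fromℕ (suc p) * (a * b ^ p) ≤ a ^ suc p + fromℕ p * b ^ suc p
  young zero {a} {b} _ _ = ≤-reflexive (solve 2 (λ a b →
    (con 1 :+ con 0) :* (a :* con 1) := a :* con 1 :+ con 0 :* (b :* con 1)) refl a b)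
  young (suc p) {a} {b} 0≤a 0≤b = +-cancelʳ-≤ (((1# + P) * a) * (a * B) + P * (a * (b * B))) (begin
    (1# + (1# + P)) * (a * (b * B)) + (((1# + P) * a) * (a * B) + P * (a * (b * B)))
      ≈⟨ solve 4 (λ a b P B →
           (con 1 :+ (con 1 :+ P)) :* (a :* (b :* B)) :+ (((con 1 :+ P) :* a) :* (a :* B) :+ P :* (a :* (b :* B)))
           := a :* ((con 1 :+ P) :* (a :* B)) :+ ((con 1 :+ P) :* B) :* (a :* b :+ a :* b))
         refl a b P B ⟩
    a * ((1# + P) * (a * B)) + ((1# + P) * B) * (a * b + a * b)
      ≤⟨ +-mono-≤ (*-monoˡ-≤ 0≤a (young p 0≤a 0≤b))
           (*-monoˡ-≤ (*-nonNeg (0≤fromℕ (suc p)) (^-nonNeg p 0≤b)) (2xy≤x²+y² a b)) ⟩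
    a * (a * A + P * (b * B)) + ((1# + P) * B) * (a * a + b * b)
      ≈⟨ solve 5 (λ a b P A B →
           a :* (a :* A :+ P :* (b :* B)) :+ ((con 1 :+ P) :* B) :* (a :* a :+ b :* b)
           := (a :* (a :* A) :+ (con 1 :+ P) :* (b :* (b :* B)))
              :+ (((con 1 :+ P) :* a) :* (a :* B) :+ P :* (a :* (b :* B))))
         refl a b P A B ⟩
    (a * (a * A) + (1# + P) * (b * (b * B))) + (((1# + P) * a) * (a * B) + P * (a * (b * B))) ∎)
    where
    P A B : Carrier
    P = fromℕ p
    A = a ^ p
    B = b ^ p

  inv : ∀ n .{{_ : NonZero n}} → Carrier
  inv n = 1# / n

  /≈*inv : ∀ x n .{{_ : NonZero n}} → x / n ≈ x * inv n
  /≈*inv x n = *-congˡ (sym (*-identityˡ _))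

  fromℕ*inv≈1 : ∀ n .{{_ : NonZero n}} → fromℕ n * inv n ≈ 1#
  fromℕ*inv≈1 n = trans (*-congˡ (*-identityˡ _)) (proj₂ (inverse (fromℕ n) (fromℕ≉0 n)))

  0≤inv : ∀ n .{{_ : NonZero n}} → 0# ≤ inv n
  0≤inv n = begin
    0#                        ≤⟨ *-nonNeg (0≤fromℕ n) (0≤x² (inv n)) ⟩
    fromℕ n * (inv n * inv n) ≈⟨ *-assoc _ _ _ ⟨
    fromℕ n * inv n * inv n   ≈⟨ *-congʳ (fromℕ*inv≈1 n) ⟩
    1# * inv n                ≈⟨ *-identityˡ _ ⟩
    inv n                     ∎

  fromℕ*[x/n]≈x : ∀ x n .{{_ : NonZero n}} → fromℕ n * (x / n) ≈ x
  fromℕ*[x/n]≈x x n = begin-equality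
    fromℕ n * (x / n)     ≈⟨ *-congˡ (/≈*inv x n) ⟩
    fromℕ n * (x * inv n) ≈⟨ solve 3 (λ n x i → n :* (x :* i) := x :* (n :* i)) refl _ x _ ⟩
    x * (fromℕ n * inv n) ≈⟨ *-congˡ (fromℕ*inv≈1 n) ⟩
    x * 1#                ≈⟨ *-identityʳ x ⟩
    x                     ∎

  /-nonNeg : ∀ {x} n .{{_ : NonZero n}} → 0# ≤ x → 0# ≤ x / n
  /-nonNeg {x} n 0≤x = ≤-respʳ-≈ (sym (/≈*inv x n)) (*-nonNeg 0≤x (0≤inv n))

  /-cross-≤ : ∀ {x y} m n .{{_ : NonZero m}} .{{_ : NonZero n}} →
              fromℕ n * x ≤ fromℕ m * y → x / m ≤ y / n
  /-cross-≤ {x} {y} m n nx≤my = begin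
    x / m                          ≈⟨ /≈*inv x m ⟩
    x * inv m                      ≈⟨ *-congʳ (fromℕ*[x/n]≈x x n) ⟨
    fromℕ n * (x / n) * inv m      ≈⟨ *-congʳ (*-congˡ (/≈*inv x n)) ⟩
    fromℕ n * (x * inv n) * inv m  ≈⟨ solve 4 (λ n x i j → n :* (x :* i) :* j := n :* x :* (i :* j)) refl _ x _ _ ⟩
    fromℕ n * x * (inv n * inv m)  ≤⟨ *-monoʳ-≤ (*-nonNeg (0≤inv n) (0≤inv m)) nx≤my ⟩
    fromℕ m * y * (inv n * inv m)  ≈⟨ solve 4 (λ m y i j → m :* y :* (i :* j) := m :* (y :* j) :* i) refl _ y _ _ ⟩
    fromℕ m * (y * inv m) * inv n  ≈⟨ *-congʳ (*-congˡ (/≈*inv y m)) ⟨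
    fromℕ m * (y / m) * inv n      ≈⟨ *-congʳ (fromℕ*[x/n]≈x y m) ⟩
    y * inv n                      ≈⟨ /≈*inv y n ⟨
    y / n                          ∎

  sum-nonNeg : ∀ {n} {y : Vector Carrier n} → (∀ i → 0# ≤ y i) → 0# ≤ sum y
  sum-nonNeg {zero}  0≤y = ≤-refl
  sum-nonNeg {suc n} 0≤y = +-nonNeg (0≤y 0F) (sum-nonNeg (0≤y ∘ suc))

  sum-mono-≤ : ∀ {n} {y z : Vector Carrier n} → (∀ i → y i ≤ z i) → sum y ≤ sum z
  sum-mono-≤ {zero}  y≤z = ≤-refl
  sum-mono-≤ {suc n} y≤z = +-mono-≤ (y≤z 0F) (sum-mono-≤ (y≤z ∘ suc))

  mean : ∀ {n} (y : Vector Carrier n) → (∀ i → 0# ≤ y i) →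
         ∃ λ b → 0# ≤ b × sum y ≈ fromℕ n * b
  mean {zero}  y 0≤y = 0# , ≤-refl , sym (zeroˡ 0#)
  mean {suc n} y 0≤y =
    sum y / suc n , /-nonNeg (suc n) (sum-nonNeg 0≤y) , sym (fromℕ*[x/n]≈x (sum y) (suc n))

  fromℕ-! : ∀ n → fromℕ (suc n !) ≈ fromℕ (suc n) * fromℕ (n !)
  fromℕ-! n = ×1-homo-* (suc n) (n !)

  step : Carrier → (ℕ → ℕ → Carrier) → ℕ → ℕ → Carrier
  step y V p q = fromℕ p * (y * V (pred p) q) + fromℕ q * V p (pred q)

  -- Meaningful for p + q ≡ n only, where W y p q = p! q! e_p(y); the recursion
  -- splits on whether the index 0 is among the first p places or the last q.
  W : ∀ {n} → Vector Carrier n → ℕ → ℕ → Carrier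
  W {zero}  y p q = 1#
  W {suc n} y p q = step (y 0F) (W (tail y)) p q

  step-monoʳ-≤ : ∀ {n y V U} → 0# ≤ y → (∀ p q → p ℕ.+ q ≡ n → V p q ≤ U p q) →
                 ∀ p q → p ℕ.+ q ≡ suc n → step y V p q ≤ step y U p q
  step-monoʳ-≤ {n} {y} {V} {U} 0≤y V≤U p q p+q≡1+n = +-mono-≤ (left p p+q≡1+n) (right q p+q≡1+n)
    where
    left : ∀ p → p ℕ.+ q ≡ suc n → fromℕ p * (y * V (pred p) q) ≤ fromℕ p * (y * U (pred p) q)
    left zero    _  = ≤-reflexive (trans (zeroˡ _) (sym (zeroˡ _)))
    left (suc p) eq = *-monoˡ-≤ (0≤fromℕ (suc p)) (*-monoˡ-≤ 0≤y (V≤U p q (ℕ.suc-injective eq)))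

    right : ∀ q → p ℕ.+ q ≡ suc n → fromℕ q * V p (pred q) ≤ fromℕ q * U p (pred q)
    right zero    _  = ≤-reflexive (trans (zeroˡ _) (sym (zeroˡ _)))
    right (suc q) eq = *-monoˡ-≤ (0≤fromℕ (suc q))
      (V≤U p q (ℕ.suc-injective (≡.trans (≡.sym (ℕ.+-suc p q)) eq)))

  step-monoˡ-≤ : ∀ {y z} V p q → y ≤ z → 0# ≤ V (pred p) q → step y V p q ≤ step z V p q
  step-monoˡ-≤ V p q y≤z 0≤V = +-monoˡ-≤ _ (*-monoˡ-≤ (0≤fromℕ p) (*-monoʳ-≤ 0≤V y≤z))

  fromℕ-+ : ∀ {n} p q → p ℕ.+ q ≡ n → fromℕ n ≈ fromℕ p + fromℕ q
  fromℕ-+ p q ≡.refl = ×-homo-+ 1# p q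

  -- For y ≡ c this is an equality, so among vectors with given mean W is
  -- largest at the constant one.
  W≤n!*c^p : ∀ {n} (y : Vector Carrier n) {c} → 0# ≤ c → (∀ i → 0# ≤ y i) →
             sum y ≤ fromℕ n * c → ∀ p q → p ℕ.+ q ≡ n → W y p q ≤ fromℕ (n !) * c ^ p
  W≤n!*c^p {zero}  y 0≤c 0≤y Σy≤nc zero zero _ = ≤-reflexive (solve 0 (con 1 := (con 1 :+ con 0) :* con 1) refl)
  W≤n!*c^p {suc n} y {a} 0≤a 0≤y Σy≤nc p q p+q≡1+n
    with b , 0≤b , Σ≈nb ← mean (tail y) (0≤y ∘ suc) = begin
    step (y 0F) (W (tail y)) p q
      ≤⟨ step-monoʳ-≤ (0≤y 0F) (W≤n!*c^p (tail y) 0≤b (0≤y ∘ suc) (≤-reflexive Σ≈nb)) p q p+q≡1+n ⟩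
    step (y 0F) (λ p q → fromℕ (n !) * b ^ p) p q
      ≤⟨ bound p p+q≡1+n ⟩
    fromℕ (suc n) * fromℕ (n !) * a ^ p
      ≈⟨ *-congʳ (fromℕ-! n) ⟨
    fromℕ (suc n !) * a ^ p ∎
    where
    y₀ N Q M : Carrier
    y₀ = y 0F
    N  = fromℕ n
    Q  = fromℕ q
    M  = fromℕ (n !)

    y₀+nb≤[1+n]a : y₀ + N * b ≤ (1# + N) * a
    y₀+nb≤[1+n]a = ≤-respˡ-≈ (+-congˡ Σ≈nb) Σy≤nc

    bound : ∀ p → p ℕ.+ q ≡ suc n →
            step y₀ (λ p q → M * b ^ p) p q ≤ (1# + N) * M * a ^ p
    bound zero ≡.refl = ≤-reflexive (solve 3 (λ y M N →
      con 0 :* (y :* (M :* con 1)) :+ (con 1 :+ N) :* (M :* con 1) := (con 1 :+ N) :* M :* con 1)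
      refl y₀ M N)
    bound (suc p) eq = +-cancelʳ-≤ (M * ((1# + N) * (P * (b * B)))) (begin
      ((1# + P) * (y₀ * (M * B)) + Q * (M * (b * B))) + M * ((1# + N) * (P * (b * B)))
        ≈⟨ +-congˡ (*-congˡ (*-congʳ (+-congˡ N≈P+Q))) ⟩
      ((1# + P) * (y₀ * (M * B)) + Q * (M * (b * B))) + M * ((1# + (P + Q)) * (P * (b * B)))
        ≈⟨ solve 6 (λ y b P Q M B →
             (con 1 :+ P) :* (y :* (M :* B)) :+ Q :* (M :* (b :* B)) :+ M :* ((con 1 :+ (P :+ Q)) :* (P :* (b :* B)))
             := ((con 1 :+ P) :* (M :* B)) :* (y :+ (P :+ Q) :* b))
           refl y₀ b P Q M B ⟩
      ((1# + P) * (M * B)) * (y₀ + (P + Q) * b)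
        ≈⟨ *-congˡ (+-congˡ (*-congʳ N≈P+Q)) ⟨
      ((1# + P) * (M * B)) * (y₀ + N * b)
        ≤⟨ *-monoˡ-≤ (*-nonNeg (0≤fromℕ (suc p)) (*-nonNeg (0≤fromℕ (n !)) (^-nonNeg p 0≤b))) y₀+nb≤[1+n]a ⟩
      ((1# + P) * (M * B)) * ((1# + N) * a)
        ≈⟨ solve 5 (λ a P M B N →
             ((con 1 :+ P) :* (M :* B)) :* ((con 1 :+ N) :* a)
             := (M :* (con 1 :+ N)) :* ((con 1 :+ P) :* (a :* B)))
           refl a P M B N ⟩
      (M * (1# + N)) * ((1# + P) * (a * B))
        ≤⟨ *-monoˡ-≤ (*-nonNeg (0≤fromℕ (n !)) (0≤fromℕ (suc n))) (young p 0≤a 0≤b) ⟩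
      (M * (1# + N)) * (a * A + P * (b * B))
        ≈⟨ solve 7 (λ a b P M A B N →
             (M :* (con 1 :+ N)) :* (a :* A :+ P :* (b :* B))
             := ((con 1 :+ N) :* M) :* (a :* A) :+ M :* ((con 1 :+ N) :* (P :* (b :* B))))
           refl a b P M A B N ⟩
      ((1# + N) * M) * (a * A) + M * ((1# + N) * (P * (b * B))) ∎)
      where
      P A B : Carrier
      P = fromℕ p
      A = a ^ p
      B = b ^ p
      N≈P+Q : N ≈ P + Q
      N≈P+Q = fromℕ-+ p q (ℕ.suc-injective eq)

  n!*c^p≤W-replicate : ∀ n {c} → 0# ≤ c → ∀ p q → p ℕ.+ q ≡ n →
                       fromℕ (n !) * c ^ p ≤ W (replicate n c) p q
  n!*c^p≤W-replicate zero    0≤c zero zero _ = ≤-reflexive (solve 0 ((con 1 :+ con 0) :* con 1 := con 1) refl)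
  n!*c^p≤W-replicate (suc n) {c} 0≤c p q p+q≡1+n = begin
    fromℕ (suc n !) * c ^ p                    ≈⟨ *-congʳ (fromℕ-! n) ⟩
    fromℕ (suc n) * fromℕ (n !) * c ^ p        ≈⟨ split p p+q≡1+n ⟩
    step c (λ p q → fromℕ (n !) * c ^ p) p q
      ≤⟨ step-monoʳ-≤ 0≤c (n!*c^p≤W-replicate n 0≤c) p q p+q≡1+n ⟩
    step c (W (replicate n c)) p q             ∎
    where
    split : ∀ p → p ℕ.+ q ≡ suc n →
            fromℕ (suc n) * fromℕ (n !) * c ^ p ≈ step c (λ p q → fromℕ (n !) * c ^ p) p q
    split zero ≡.refl = solve 3 (λ c M N →
      N :* M :* con 1 := con 0 :* (c :* (M :* con 1)) :+ N :* (M :* con 1))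
      refl c (fromℕ (n !)) (fromℕ (suc n))
    split (suc p) eq = trans (*-congʳ (*-congʳ (fromℕ-+ (suc p) q eq))) (solve 5 (λ c M P Q B →
      (P :+ Q) :* M :* (c :* B) := P :* (c :* (M :* B)) :+ Q :* (M :* (c :* B)))
      refl c (fromℕ (n !)) (fromℕ (suc p)) (fromℕ q) (c ^ p))

  W-nonNeg : ∀ {n} (y : Vector Carrier n) → (∀ i → 0# ≤ y i) → ∀ p q → 0# ≤ W y p q
  W-nonNeg {zero}  y 0≤y p q = 0≤1
  W-nonNeg {suc n} y 0≤y p q = +-nonNeg
    (*-nonNeg (0≤fromℕ p) (*-nonNeg (0≤y 0F) (W-nonNeg (tail y) (0≤y ∘ suc) (pred p) q)))
    (*-nonNeg (0≤fromℕ q) (W-nonNeg (tail y) (0≤y ∘ suc) p (pred q)))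

  W≤n! : ∀ {n} (y : Vector Carrier n) → (∀ i → 0# ≤ y i) → (∀ i → y i ≤ 1#) →
         ∀ p q → p ℕ.+ q ≡ n → W y p q ≤ fromℕ (n !)
  W≤n! {zero}  y 0≤y y≤1 p q _ = ≤-reflexive (sym (+-identityʳ 1#))
  W≤n! {suc n} y 0≤y y≤1 p q p+q≡1+n = begin
    step (y 0F) (W (tail y)) p q
      ≤⟨ step-monoʳ-≤ (0≤y 0F) (W≤n! (tail y) (0≤y ∘ suc) (y≤1 ∘ suc)) p q p+q≡1+n ⟩
    step (y 0F) (λ _ _ → fromℕ (n !)) p q
      ≤⟨ step-monoˡ-≤ (λ _ _ → fromℕ (n !)) p q (y≤1 0F) (0≤fromℕ (n !)) ⟩
    step 1# (λ _ _ → fromℕ (n !)) p q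
      ≈⟨ solve 3 (λ P Q M → P :* (con 1 :* M) :+ Q :* M := (P :+ Q) :* M) refl (fromℕ p) (fromℕ q) (fromℕ (n !)) ⟩
    (fromℕ p + fromℕ q) * fromℕ (n !)
      ≈⟨ *-congʳ (fromℕ-+ p q p+q≡1+n) ⟨
    fromℕ (suc n) * fromℕ (n !)
      ≈⟨ fromℕ-! n ⟨
    fromℕ (suc n !) ∎

  -- The bound is the value of W at (0, 1, …, 1).
  W≤n!*q : ∀ {n} (y : Vector Carrier (suc n)) → (∀ i → 0# ≤ y i) → (∀ i → y i ≤ 1#) →
           ∀ i → y i ≈ 0# → ∀ p q → p ℕ.+ q ≡ suc n → W y p q ≤ fromℕ (n !) * fromℕ q
  W≤n!*q {n} y 0≤y y≤1 zero y₀≈0 p q p+q≡1+n = begin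
    step (y 0F) (W (tail y)) p q
      ≤⟨ step-monoʳ-≤ (0≤y 0F) (W≤n! (tail y) (0≤y ∘ suc) (y≤1 ∘ suc)) p q p+q≡1+n ⟩
    step (y 0F) (λ _ _ → fromℕ (n !)) p q
      ≤⟨ step-monoˡ-≤ (λ _ _ → fromℕ (n !)) p q (≤-reflexive y₀≈0) (0≤fromℕ (n !)) ⟩
    step 0# (λ _ _ → fromℕ (n !)) p q
      ≈⟨ solve 3 (λ P Q M → P :* (con 0 :* M) :+ Q :* M := M :* Q) refl (fromℕ p) (fromℕ q) (fromℕ (n !)) ⟩
    fromℕ (n !) * fromℕ q ∎
  W≤n!*q {suc n} y 0≤y y≤1 (suc i) yᵢ≈0 p q p+q≡2+n = begin
    step (y 0F) (W (tail y)) p q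
      ≤⟨ step-monoʳ-≤ (0≤y 0F) (W≤n!*q (tail y) (0≤y ∘ suc) (y≤1 ∘ suc) i yᵢ≈0) p q p+q≡2+n ⟩
    step (y 0F) (λ p q → fromℕ (n !) * fromℕ q) p q
      ≤⟨ step-monoˡ-≤ (λ p q → fromℕ (n !) * fromℕ q) p q (y≤1 0F) (*-nonNeg (0≤fromℕ (n !)) (0≤fromℕ q)) ⟩
    step 1# (λ p q → fromℕ (n !) * fromℕ q) p q
      ≈⟨ collect q p+q≡2+n ⟩
    fromℕ (suc n) * fromℕ (n !) * fromℕ q
      ≈⟨ *-congʳ (fromℕ-! n) ⟨
    fromℕ (suc n !) * fromℕ q ∎
    where
    collect : ∀ q → p ℕ.+ q ≡ 2+ n →
              step 1# (λ p q → fromℕ (n !) * fromℕ q) p q ≈ fromℕ (suc n) * fromℕ (n !) * fromℕ q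
    collect zero    _  = solve 3 (λ P M N → P :* (con 1 :* (M :* con 0)) :+ con 0 :* (M :* con 0) := N :* M :* con 0)
      refl (fromℕ p) (fromℕ (n !)) (fromℕ (suc n))
    collect (suc q) eq = trans
      (solve 3 (λ P Q M → P :* (con 1 :* (M :* (con 1 :+ Q))) :+ (con 1 :+ Q) :* (M :* Q)
                          := (P :+ Q) :* M :* (con 1 :+ Q)) refl (fromℕ p) (fromℕ q) (fromℕ (n !)))
      (sym (*-congʳ (*-congʳ (fromℕ-+ p q (ℕ.suc-injective (≡.trans (≡.sym (ℕ.+-suc p q)) eq))))))

  antidiagonal : ∀ n → (ℕ → ℕ → Carrier) → Carrier
  antidiagonal n f = sum {suc n} (λ a → f (toℕ a) (n ∸ toℕ a))

  toℕ+[n∸toℕ]≡n : ∀ {n} (a : Fin (suc n)) → toℕ a ℕ.+ (n ∸ toℕ a) ≡ n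
  toℕ+[n∸toℕ]≡n a = ℕ.m+[n∸m]≡n (toℕ≤pred[n] a)

  antidiagonal-cong : ∀ {n f g} → (∀ p q → p ℕ.+ q ≡ n → f p q ≈ g p q) →
                      antidiagonal n f ≈ antidiagonal n g
  antidiagonal-cong {n} f≈g = sum-cong-≋ {suc n} (λ a → f≈g (toℕ a) (n ∸ toℕ a) (toℕ+[n∸toℕ]≡n a))

  antidiagonal-mono-≤ : ∀ {n f g} → (∀ p q → p ℕ.+ q ≡ n → f p q ≤ g p q) →
                        antidiagonal n f ≤ antidiagonal n g
  antidiagonal-mono-≤ {n} f≤g = sum-mono-≤ (λ a → f≤g (toℕ a) (n ∸ toℕ a) (toℕ+[n∸toℕ]≡n a))

  antidiagonal-+ : ∀ n f g → antidiagonal n (λ p q → f p q + g p q) ≈ antidiagonal n f + antidiagonal n g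
  antidiagonal-+ n f g = ∑-distrib-+ {suc n} (λ a → f (toℕ a) (n ∸ toℕ a)) (λ a → g (toℕ a) (n ∸ toℕ a))

  antidiagonal-*ˡ : ∀ n x f → x * antidiagonal n f ≈ antidiagonal n (λ p q → x * f p q)
  antidiagonal-*ˡ n x f = *-distribˡ-sum {suc n} x (λ a → f (toℕ a) (n ∸ toℕ a))

  antidiagonal-last : ∀ n f → antidiagonal (suc n) f ≈ antidiagonal n (λ p q → f p (suc q)) + f (suc n) 0
  antidiagonal-last zero    f = solve 2 (λ x y → x :+ (y :+ con 0) := (x :+ con 0) :+ y) refl (f 0 1) (f 1 0)
  antidiagonal-last (suc n) f =
    trans (+-congˡ (antidiagonal-last n (λ p q → f (suc p) q))) (sym (+-assoc _ _ _))

  antidiagonal-step : ∀ n y V → antidiagonal (suc n) (step y V) ≈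
                      antidiagonal n (λ p q → (fromℕ (suc p) * y + fromℕ (suc q) * 1#) * V p q)
  antidiagonal-step n y V = begin-equality
    antidiagonal (suc n) (step y V)
      ≈⟨ antidiagonal-+ (suc n) L R ⟩
    antidiagonal (suc n) L + antidiagonal (suc n) R
      ≈⟨ +-cong (trans (+-congʳ (zeroˡ _)) (+-identityˡ _))
           (trans (antidiagonal-last n R) (trans (+-congˡ (zeroˡ _)) (+-identityʳ _))) ⟩
    antidiagonal n (λ p q → L (suc p) q) + antidiagonal n (λ p q → R p (suc q))
      ≈⟨ antidiagonal-+ n (λ p q → L (suc p) q) (λ p q → R p (suc q)) ⟨
    antidiagonal n (λ p q → L (suc p) q + R p (suc q))
      ≈⟨ antidiagonal-cong {n} (λ p q _ → solve 4 (λ P Q y V →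
           P :* (y :* V) :+ Q :* V := (P :* y :+ Q :* con 1) :* V) refl (fromℕ (suc p)) (fromℕ (suc q)) y (V p q)) ⟩
    antidiagonal n (λ p q → (fromℕ (suc p) * y + fromℕ (suc q) * 1#) * V p q) ∎
    where
    L R : ℕ → ℕ → Carrier
    L p q = fromℕ p * (y * V (pred p) q)
    R p q = fromℕ q * V p (pred q)

  D : ∀ n → Carrier → Carrier → (ℕ → ℕ → Carrier) → Carrier
  D n α β V = antidiagonal n (λ p q → (fromℕ (suc p) * α + fromℕ (suc q) * β) * V p q)

  D-mono-≤ : ∀ {n α β V U} → 0# ≤ α → 0# ≤ β → (∀ p q → p ℕ.+ q ≡ n → V p q ≤ U p q) →
             D n α β V ≤ D n α β U
  D-mono-≤ {n} 0≤α 0≤β V≤U = antidiagonal-mono-≤ {n} (λ p q eq → *-monoˡ-≤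
    (+-nonNeg (*-nonNeg (0≤fromℕ (suc p)) 0≤α) (*-nonNeg (0≤fromℕ (suc q)) 0≤β)) (V≤U p q eq))

  D-linear : ∀ n x y a b V → x * D n a 1# V + y * D n b 1# V ≈ D n (x * a + y * b) (x + y) V
  D-linear n x y a b V = begin-equality
    x * D n a 1# V + y * D n b 1# V
      ≈⟨ +-cong (antidiagonal-*ˡ n x (f a)) (antidiagonal-*ˡ n y (f b)) ⟩
    antidiagonal n (λ p q → x * f a p q) + antidiagonal n (λ p q → y * f b p q)
      ≈⟨ antidiagonal-+ n (λ p q → x * f a p q) (λ p q → y * f b p q) ⟨
    antidiagonal n (λ p q → x * f a p q + y * f b p q)
      ≈⟨ antidiagonal-cong {n} (λ p q _ → solve 7 (λ x y a b P Q V →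
           x :* ((P :* a :+ Q :* con 1) :* V) :+ y :* ((P :* b :+ Q :* con 1) :* V)
           := (P :* (x :* a :+ y :* b) :+ Q :* (x :+ y)) :* V)
         refl x y a b (fromℕ (suc p)) (fromℕ (suc q)) (V p q)) ⟩
    D n (x * a + y * b) (x + y) V ∎
    where
    f : Carrier → ℕ → ℕ → Carrier
    f z p q = (fromℕ (suc p) * z + fromℕ (suc q) * 1#) * V p q

  -- The parameter γ absorbs the shift of p in the induction; the case γ = 0 is
  -- the one of interest.
  antidiagonal-cubic : ∀ n α β γ → let N = fromℕ n in
    fromℕ 6 * antidiagonal n (λ p q → (γ + fromℕ (suc p) * α + fromℕ (suc q) * β) * fromℕ q)
    ≈ fromℕ 3 * (N * (1# + N)) * γ + N * (1# + N) * (1# + (1# + N)) * (α + (β + β))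
  antidiagonal-cubic zero α β γ = solve 5 (λ s t α β γ →
    s :* ((γ :+ lit 1 :* α :+ lit 1 :* β) :* con 0 :+ con 0)
    := t :* (con 0 :* lit 1) :* γ :+ con 0 :* lit 1 :* (con 1 :+ lit 1) :* (α :+ (β :+ β)))
    refl (fromℕ 6) (fromℕ 3) α β γ
  antidiagonal-cubic (suc n) α β γ = begin-equality
    fromℕ 6 * ((γ + fromℕ 1 * α + fromℕ (2+ n) * β) * fromℕ (suc n)
      + antidiagonal n (λ p q → (γ + fromℕ (2+ p) * α + fromℕ (suc q) * β) * fromℕ q))
      ≈⟨ *-congˡ (+-congˡ (antidiagonal-cong {n} (λ p q _ → *-congʳ {fromℕ q} (+-congʳ {fromℕ (suc q) * β}
           (solve 3 (λ γ P α → γ :+ (con 1 :+ P) :* α := γ :+ α :+ P :* α) refl γ (fromℕ (suc p)) α))))) ⟩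
    fromℕ 6 * ((γ + fromℕ 1 * α + fromℕ (2+ n) * β) * fromℕ (suc n)
      + antidiagonal n (λ p q → (γ + α + fromℕ (suc p) * α + fromℕ (suc q) * β) * fromℕ q))
      ≈⟨ distribˡ _ _ _ ⟩
    fromℕ 6 * ((γ + fromℕ 1 * α + fromℕ (2+ n) * β) * fromℕ (suc n))
      + fromℕ 6 * antidiagonal n (λ p q → (γ + α + fromℕ (suc p) * α + fromℕ (suc q) * β) * fromℕ q)
      ≈⟨ +-congˡ (antidiagonal-cubic n α β (γ + α)) ⟩
    fromℕ 6 * ((γ + fromℕ 1 * α + fromℕ (2+ n) * β) * fromℕ (suc n))
      + (fromℕ 3 * (N * (1# + N)) * (γ + α) + N * (1# + N) * (1# + (1# + N)) * (α + (β + β)))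
      ≈⟨ solve 4 (λ α β γ N →
           lit 6 :* ((γ :+ lit 1 :* α :+ (con 1 :+ (con 1 :+ N)) :* β) :* (con 1 :+ N))
           :+ (lit 3 :* (N :* (con 1 :+ N)) :* (γ :+ α)
               :+ N :* (con 1 :+ N) :* (con 1 :+ (con 1 :+ N)) :* (α :+ (β :+ β)))
           := lit 3 :* ((con 1 :+ N) :* (con 1 :+ (con 1 :+ N))) :* γ
              :+ (con 1 :+ N) :* (con 1 :+ (con 1 :+ N)) :* (con 1 :+ (con 1 :+ (con 1 :+ N))) :* (α :+ (β :+ β)))
         refl α β γ N ⟩
    _ ∎
    where
    N : Carrier
    N = fromℕ n

  D-extremal : ∀ n {α β V y} → 0# ≤ α → 0# ≤ β → (∀ i → 0# ≤ y i) →
               (∀ p q → p ℕ.+ q ≡ suc n → V p q ≤ fromℕ (n !) * fromℕ q) →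
               fromℕ (3 !) * D (suc n) α β V ≤ fromℕ ((3 ℕ.+ n) !) * D 1 α β (W {1} y)
  D-extremal n {α} {β} {V} {y} 0≤α 0≤β 0≤y V≤n!*q = begin
    fromℕ 6 * D (suc n) α β V
      ≤⟨ *-monoˡ-≤ (0≤fromℕ 6) (D-mono-≤ 0≤α 0≤β V≤n!*q) ⟩
    fromℕ 6 * D (suc n) α β (λ p q → M * fromℕ q)
      ≈⟨ *-congˡ (antidiagonal-cong {suc n} (λ p q _ → solve 6 (λ α β P Q M q →
           (P :* α :+ Q :* β) :* (M :* q) := M :* ((con 0 :+ P :* α :+ Q :* β) :* q))
           refl α β (fromℕ (suc p)) (fromℕ (suc q)) M (fromℕ q))) ⟩
    fromℕ 6 * antidiagonal (suc n) (λ p q → M * cubic p q)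
      ≈⟨ *-congˡ (antidiagonal-*ˡ (suc n) M cubic) ⟨
    fromℕ 6 * (M * antidiagonal (suc n) cubic)
      ≈⟨ solve 3 (λ s M A → s :* (M :* A) := M :* (s :* A)) refl (fromℕ 6) M (antidiagonal (suc n) cubic) ⟩
    M * (fromℕ 6 * antidiagonal (suc n) cubic)
      ≈⟨ *-congˡ (antidiagonal-cubic (suc n) α β 0#) ⟩
    M * (fromℕ 3 * (N * (1# + N)) * 0# + N * (1# + N) * (1# + (1# + N)) * (α + (β + β)))
      ≈⟨ solve 5 (λ α β M N t →
           M :* (t :* (N :* (con 1 :+ N)) :* con 0 :+ N :* (con 1 :+ N) :* (con 1 :+ (con 1 :+ N)) :* (α :+ (β :+ β)))
           := ((con 1 :+ (con 1 :+ N)) :* ((con 1 :+ N) :* (N :* M))) :* (α :+ (β :+ β)))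
         refl α β M N (fromℕ 3) ⟩
    ((1# + (1# + N)) * ((1# + N) * (N * M))) * (α + (β + β))
      ≈⟨ *-congʳ (trans (fromℕ-! (2+ n)) (*-congˡ (trans (fromℕ-! (suc n)) (*-congˡ (fromℕ-! n))))) ⟨
    fromℕ ((3 ℕ.+ n) !) * (α + (β + β))
      ≤⟨ *-monoˡ-≤ (0≤fromℕ ((3 ℕ.+ n) !)) (x≤x+y (*-nonNeg
           (+-nonNeg (*-nonNeg (0≤fromℕ 2) 0≤α) (*-nonNeg (0≤fromℕ 1) 0≤β)) (W-nonNeg y 0≤y 1 0))) ⟩
    fromℕ ((3 ℕ.+ n) !) * (α + (β + β) + (fromℕ 2 * α + fromℕ 1 * β) * W y 1 0)
      ≈⟨ *-congˡ (solve 4 (λ α β y v →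
           α :+ (β :+ β) :+ v
           := (lit 1 :* α :+ lit 2 :* β) :* (con 0 :* (y :* con 1) :+ lit 1 :* con 1) :+ (v :+ con 0))
         refl α β (y 0F) _) ⟩
    fromℕ ((3 ℕ.+ n) !) * D 1 α β (W y) ∎
    where
    M N : Carrier
    M = fromℕ (n !)
    N = fromℕ (suc n)
    cubic : ℕ → ℕ → Carrier
    cubic p q = (0# + fromℕ (suc p) * α + fromℕ (suc q) * β) * fromℕ q

  -- Sums over permutations

  open Density K
  open Min totalOrder using (x⊓y≤x; x⊓y≤y; ⊓-glb; x≤y⇒x⊓y≈x; x≤y⇒y⊓x≈x)

  Σ-list-++-map : ∀ {a} {A : Set a} (g : A → Carrier) xs ys →
                  Σ-list (map g (xs ++ ys)) ≈ Σ-list (map g xs) + Σ-list (map g ys)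
  Σ-list-++-map g []       ys = sym (+-identityˡ _)
  Σ-list-++-map g (x ∷ xs) ys = trans (+-congˡ (Σ-list-++-map g xs ys)) (sym (+-assoc _ _ _))

  Σ-list-map-∘ : ∀ {a b} {A : Set a} {B : Set b} (g : B → Carrier) (f : A → B) xs →
                 Σ-list (map g (map f xs)) ≈ Σ-list (map (g ∘ f) xs)
  Σ-list-map-∘ g f []       = refl
  Σ-list-map-∘ g f (x ∷ xs) = +-congˡ (Σ-list-map-∘ g f xs)

  Σ-list-cong : ∀ {a} {A : Set a} {f g : A → Carrier} → (∀ x → f x ≈ g x) →
                ∀ xs → Σ-list (map f xs) ≈ Σ-list (map g xs)
  Σ-list-cong f≈g []       = refl
  Σ-list-cong f≈g (x ∷ xs) = +-cong (f≈g x) (Σ-list-cong f≈g xs)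

  Σ-list-+ : ∀ {a} {A : Set a} (f g : A → Carrier) xs →
             Σ-list (map (λ x → f x + g x) xs) ≈ Σ-list (map f xs) + Σ-list (map g xs)
  Σ-list-+ f g []       = sym (+-identityˡ 0#)
  Σ-list-+ f g (x ∷ xs) = trans (+-congˡ (Σ-list-+ f g xs))
    (solve 4 (λ a b c d → (a :+ b) :+ (c :+ d) := (a :+ c) :+ (b :+ d)) refl (f x) (g x) _ _)

  Σ-list-*ˡ : ∀ {a} {A : Set a} y (f : A → Carrier) xs →
              Σ-list (map (λ x → y * f x) xs) ≈ y * Σ-list (map f xs)
  Σ-list-*ˡ y f []       = sym (zeroʳ y)
  Σ-list-*ˡ y f (x ∷ xs) = trans (+-congˡ (Σ-list-*ˡ y f xs)) (sym (distribˡ y _ _))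

  Σ-list-product : ∀ {a b c} {A : Set a} {B : Set b} {C : Set c} (g : C → Carrier) (f : A → B → C)
                   {n} (h : Fin n → A) ys →
                   Σ-list (map g (cartesianProductWith f (tabulate h) ys))
                   ≈ sum (λ a → Σ-list (map (g ∘ f (h a)) ys))
  Σ-list-product g f {zero}  h ys = refl
  Σ-list-product g f {suc n} h ys = trans
    (Σ-list-++-map g (map (f (h 0F)) ys) _)
    (+-cong (Σ-list-map-∘ g (f (h 0F)) ys) (Σ-list-product g f (h ∘ suc) ys))

  Σ-perm : ∀ n → (Permutation′ n → Carrier) → Carrier
  Σ-perm n g = Σ-list (map g (permutations n))

  Σ-perm-suc : ∀ n g → Σ-perm (suc n) g ≈ sum (λ a → Σ-perm n (g ∘ insert 0F a))
  Σ-perm-suc n g = Σ-list-product g (insert 0F) id (permutations n)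

  Σ-perm-cong : ∀ {n f g} → (∀ σ → f σ ≈ g σ) → Σ-perm n f ≈ Σ-perm n g
  Σ-perm-cong {n} f≈g = Σ-list-cong f≈g (permutations n)

  Σ-perm-*ˡ : ∀ n x g → Σ-perm n (λ σ → x * g σ) ≈ x * Σ-perm n g
  Σ-perm-*ˡ n x g = Σ-list-*ˡ x g (permutations n)

  select : ∀ {n} → (Fin n → Bool) → Vector Carrier n → Carrier
  select {zero}  b y = 1#
  select {suc n} b y = (if b 0F then y 0F else 1#) * select (b ∘ suc) (tail y)

  select-cong : ∀ {n} {b b′ : Fin n → Bool} → (∀ i → b i ≡ b′ i) → ∀ y → select b y ≈ select b′ y
  select-cong {zero}  b≡b′ y = refl
  select-cong {suc n} b≡b′ y = *-cong
    (reflexive (≡.cong (if_then y 0F else 1#) (b≡b′ 0F))) (select-cong (b≡b′ ∘ suc) (tail y))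

  Π-filter : ∀ {a p} {A : Set a} {P : A → Set p} (P? : Decidable P) (g : A → Carrier) {n} (f : Fin n → A) →
             Π-list (map g (filter P? (tabulate f))) ≈ select (does ∘ P? ∘ f) (g ∘ f)
  Π-filter P? g {zero}  f = refl
  Π-filter P? g {suc n} f with does (P? (f 0F))
  ... | true  = *-congˡ (Π-filter P? g (f ∘ suc))
  ... | false = trans (Π-filter P? g (f ∘ suc)) (sym (*-identityˡ _))

  before : ∀ {n} → ℕ → Vector Carrier n → Permutation′ n → Carrier
  before p y σ = select (λ i → toℕ (σ ⟨$⟩ʳ i) <ᵇ p) y

  n<ᵇn : ∀ n → (n <ᵇ n) ≡ false
  n<ᵇn zero    = ≡.refl
  n<ᵇn (suc n) = n<ᵇn n

  punchIn-<ᵇ : ∀ {n} (a : Fin (suc n)) (r : Fin n) p →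
               (toℕ (punchIn a r) <ᵇ p) ≡ (toℕ r <ᵇ (if toℕ a <ᵇ p then pred p else p))
  punchIn-<ᵇ zero    r       zero          = ≡.refl
  punchIn-<ᵇ zero    r       (suc p)       = ≡.refl
  punchIn-<ᵇ (suc a) r       zero          = ≡.refl
  punchIn-<ᵇ (suc a) zero    (suc zero)    = ≡.refl
  punchIn-<ᵇ (suc a) zero    (suc (suc p)) with toℕ a <ᵇ suc p
  ... | true  = ≡.refl
  ... | false = ≡.refl
  punchIn-<ᵇ (suc a) (suc r) (suc zero)    = punchIn-<ᵇ a r zero
  punchIn-<ᵇ (suc a) (suc r) (suc (suc p)) with toℕ a <ᵇ suc p | punchIn-<ᵇ a r (suc p)
  ... | true  | eq = eq
  ... | false | eq = eq

  punchIn-<ᵇ-punchIn : ∀ {n} (a : Fin (suc n)) (r s : Fin n) →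
                       (toℕ (punchIn a r) <ᵇ toℕ (punchIn a s)) ≡ (toℕ r <ᵇ toℕ s)
  punchIn-<ᵇ-punchIn zero    r       s       = ≡.refl
  punchIn-<ᵇ-punchIn (suc a) r       zero    = ≡.refl
  punchIn-<ᵇ-punchIn (suc a) zero    (suc s) = ≡.refl
  punchIn-<ᵇ-punchIn (suc a) (suc r) (suc s) = punchIn-<ᵇ-punchIn a r s

  <ᵇ-punchIn : ∀ {n} (a : Fin (suc n)) (s : Fin n) →
               (toℕ a <ᵇ toℕ (punchIn a s)) ≡ (toℕ a <ᵇ suc (toℕ s))
  <ᵇ-punchIn zero    s       = ≡.refl
  <ᵇ-punchIn (suc a) zero    = ≡.refl
  <ᵇ-punchIn (suc a) (suc s) = <ᵇ-punchIn a s

  insert-suc : ∀ {n} a (ρ : Permutation′ n) i → insert 0F a ρ ⟨$⟩ʳ suc i ≡ punchIn a (ρ ⟨$⟩ʳ i)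
  insert-suc = insert-punchIn 0F

  before-insert : ∀ {n} p y a (ρ : Permutation′ n) → before p y (insert 0F a ρ) ≈
    (if toℕ a <ᵇ p then y 0F else 1#) * before (if toℕ a <ᵇ p then pred p else p) (tail y) ρ
  before-insert p y a ρ = *-congˡ (select-cong (λ i → ≡.trans
    (≡.cong (λ j → toℕ j <ᵇ p) (insert-suc a ρ i)) (punchIn-<ᵇ a (ρ ⟨$⟩ʳ i) p)) (tail y))

  sum-if : ∀ {n} p q → p ℕ.+ q ≡ n → ∀ x y →
           sum {n} (λ a → if toℕ a <ᵇ p then x else y) ≈ fromℕ p * x + fromℕ q * y
  sum-if {zero}  zero    zero    _  x y = solve 2 (λ x y → con 0 := con 0 :* x :+ con 0 :* y) refl x y
  sum-if {suc n} zero    (suc q) eq x y = trans (+-congˡ (sum-if zero q (ℕ.suc-injective eq) x y))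
    (solve 3 (λ x y Q → y :+ (con 0 :* x :+ Q :* y) := con 0 :* x :+ (con 1 :+ Q) :* y) refl x y (fromℕ q))
  sum-if {suc n} (suc p) q       eq x y = trans (+-congˡ (sum-if p q (ℕ.suc-injective eq) x y))
    (solve 4 (λ x y P Q → x :+ (P :* x :+ Q :* y) := (con 1 :+ P) :* x :+ Q :* y) refl x y (fromℕ p) (fromℕ q))

  Σ-before : ∀ {n} (y : Vector Carrier n) p q → p ℕ.+ q ≡ n → Σ-perm n (before p y) ≈ W y p q
  Σ-before {zero}  y p q _ = +-identityʳ 1#
  Σ-before {suc n} y p q p+q≡1+n = begin-equality
    Σ-perm (suc n) (before p y)
      ≈⟨ Σ-perm-suc n (before p y) ⟩
    sum (λ a → Σ-perm n (before p y ∘ insert 0F a))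
      ≈⟨ sum-cong-≋ (λ a → trans (Σ-perm-cong (before-insert p y a)) (inner p q p+q≡1+n a)) ⟩
    sum {suc n} (λ a → if toℕ a <ᵇ p then y 0F * W (tail y) (pred p) q else W (tail y) p (pred q))
      ≈⟨ sum-if p q p+q≡1+n _ _ ⟩
    W y p q ∎
    where
    inner : ∀ p q → p ℕ.+ q ≡ suc n → ∀ (a : Fin (suc n)) →
      Σ-perm n (λ ρ → (if toℕ a <ᵇ p then y 0F else 1#) * before (if toℕ a <ᵇ p then pred p else p) (tail y) ρ)
      ≈ (if toℕ a <ᵇ p then y 0F * W (tail y) (pred p) q else W (tail y) p (pred q))
    inner p q eq a with toℕ a <ᵇ p in a<ᵇp
    inner (suc p) q eq a | true = trans (Σ-perm-*ˡ n (y 0F) (before p (tail y)))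
      (*-congˡ (Σ-before (tail y) p q (ℕ.suc-injective eq)))
    inner p (suc q) eq a | false = trans (Σ-perm-*ˡ n 1# (before p (tail y)))
      (trans (*-identityˡ _)
        (Σ-before (tail y) p q (ℕ.suc-injective (≡.trans (≡.sym (ℕ.+-suc p q)) eq))))
    inner p zero eq a | false with () ← ≡.subst T a<ᵇp (ℕ.<⇒<ᵇ
      (≡.subst (toℕ a ℕ.<_) (≡.trans (≡.sym eq) (ℕ.+-identityʳ p)) (toℕ<n a)))

  Σ-before-zeroth : ∀ {n} (y : Vector Carrier (suc n)) →
    Σ-perm (suc n) (λ σ → before (toℕ (σ ⟨$⟩ʳ 0F)) y σ) ≈ antidiagonal n (W (tail y))
  Σ-before-zeroth {n} y = begin-equality
    Σ-perm (suc n) (λ σ → before (toℕ (σ ⟨$⟩ʳ 0F)) y σ)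
      ≈⟨ Σ-perm-suc n _ ⟩
    sum (λ a → Σ-perm n (λ ρ → before (toℕ a) y (insert 0F a ρ)))
      ≈⟨ sum-cong-≋ (λ a → trans (Σ-perm-cong (drop a))
           (Σ-before (tail y) (toℕ a) (n ∸ toℕ a) (toℕ+[n∸toℕ]≡n a))) ⟩
    antidiagonal n (W (tail y)) ∎
    where
    drop : ∀ (a : Fin (suc n)) ρ → before (toℕ a) y (insert 0F a ρ) ≈ before (toℕ a) (tail y) ρ
    drop a ρ with eq ← before-insert (toℕ a) y a ρ rewrite n<ᵇn (toℕ a) = trans eq (*-identityˡ _)

  Σ-before-first : ∀ {n} (y : Vector Carrier (2+ n)) →
    Σ-perm (2+ n) (λ σ → before (toℕ (σ ⟨$⟩ʳ 1F)) y σ) ≈ D n (y 0F) 1# (W (tail (tail y)))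
  Σ-before-first {n} y = begin-equality
    Σ-perm (2+ n) g
      ≈⟨ Σ-perm-suc (suc n) g ⟩
    sum (λ a → Σ-perm (suc n) (g ∘ insert 0F a))
      ≈⟨ sum-cong-≋ {2+ n} (λ a → trans (Σ-perm-suc n (g ∘ insert 0F a)) (sum-cong-≋ {suc n} (λ b →
           trans (Σ-perm-cong (split a b)) (trans (Σ-perm-*ˡ n (coefficient a b) (before (toℕ b) z))
             (*-congˡ (Σ-before z (toℕ b) (n ∸ toℕ b) (toℕ+[n∸toℕ]≡n b))))))) ⟩
    sum {2+ n} (λ a → sum {suc n} (λ b → coefficient a b * V b))
      ≈⟨ ∑-comm (λ a b → coefficient a b * V b) ⟩
    sum {suc n} (λ b → sum {2+ n} (λ a → coefficient a b * V b))
      ≈⟨ sum-cong-≋ {suc n} (λ b → trans (sym (*-distribʳ-sum (V b) (λ a → coefficient a b)))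
           (*-congʳ (sum-if (suc (toℕ b)) (suc (n ∸ toℕ b))
             (≡.cong suc (≡.trans (ℕ.+-suc (toℕ b) _) (≡.cong suc (toℕ+[n∸toℕ]≡n b)))) (y 0F) 1#))) ⟩
    D n (y 0F) 1# (W z) ∎
    where
    g : Permutation′ (2+ n) → Carrier
    g σ = before (toℕ (σ ⟨$⟩ʳ 1F)) y σ

    z : Vector Carrier n
    z = tail (tail y)

    V : Fin (suc n) → Carrier
    V b = W z (toℕ b) (n ∸ toℕ b)

    coefficient : Fin (2+ n) → Fin (suc n) → Carrier
    coefficient a b = if toℕ a <ᵇ suc (toℕ b) then y 0F else 1#

    split : ∀ a b ρ → let σ = insert 0F a (insert 0F b ρ) in
            before (toℕ (σ ⟨$⟩ʳ 1F)) y σ ≈ coefficient a b * before (toℕ b) z ρ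
    split a b ρ = *-cong
      (reflexive (≡.cong (if_then y 0F else 1#) (≡.trans
        (≡.cong (λ j → toℕ a <ᵇ toℕ j) σ1) (<ᵇ-punchIn a b))))
      (trans (*-cong (reflexive (≡.cong (if_then y 1F else 1#) (n<ᵇn (toℕ (σ ⟨$⟩ʳ 1F)))))
                     (select-cong compare z))
        (*-identityˡ _))
      where
      σ : Permutation′ (2+ n)
      σ = insert 0F a (insert 0F b ρ)

      σ1 : σ ⟨$⟩ʳ 1F ≡ punchIn a b
      σ1 = insert-suc a (insert 0F b ρ) 0F

      compare : ∀ i → (toℕ (σ ⟨$⟩ʳ suc (suc i)) <ᵇ toℕ (σ ⟨$⟩ʳ 1F)) ≡ (toℕ (ρ ⟨$⟩ʳ i) <ᵇ toℕ b)
      compare i rewrite σ1 | insert-suc a (insert 0F b ρ) (suc i) | insert-suc b ρ i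
                      | punchIn-<ᵇ-punchIn a (punchIn b (ρ ⟨$⟩ʳ i)) b
                      | punchIn-<ᵇ b (ρ ⟨$⟩ʳ i) (toℕ b) | n<ᵇn (toℕ b) = ≡.refl

  weight : Carrier → Carrier
  weight z = 1# - F z

  slope offset : Carrier → Carrier → Carrier
  slope  x₁ x₂ = F′ x₁ * weight x₂ + F′ x₂ * weight x₁
  offset x₁ x₂ = F′ x₁ + F′ x₂

  d≈D : ∀ {m} (x : Vector Carrier (2+ m)) → d x ≈
    (D m (slope (x 0F) (x 1F)) (offset (x 0F) (x 1F))
       (W (λ i → weight (x (2 ↑ʳ i)))) / (2+ m !)) {{2+ m ℕ.!≢0}}
  d≈D {m} x = *-congʳ (begin-equality
    Σ-perm k (λ σ → term x σ 0F + term x σ 1F)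
      ≈⟨ Σ-list-+ (λ σ → term x σ 0F) (λ σ → term x σ 1F) (permutations k) ⟩
    Σ-perm k (λ σ → term x σ 0F) + Σ-perm k (λ σ → term x σ 1F)
      ≈⟨ +-cong (factor 0F) (factor 1F) ⟩
    F′ (x 0F) * Σ-perm k (λ σ → before (toℕ (σ ⟨$⟩ʳ 0F)) y σ)
      + F′ (x 1F) * Σ-perm k (λ σ → before (toℕ (σ ⟨$⟩ʳ 1F)) y σ)
      ≈⟨ +-cong (*-congˡ (trans (Σ-before-zeroth y) (antidiagonal-step m (y 1F) (W z))))
                (*-congˡ (Σ-before-first y)) ⟩
    F′ (x 0F) * D m (y 1F) 1# (W z) + F′ (x 1F) * D m (y 0F) 1# (W z)
      ≈⟨ D-linear m (F′ (x 0F)) (F′ (x 1F)) (y 1F) (y 0F) (W z) ⟩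
    D m (slope (x 0F) (x 1F)) (offset (x 0F) (x 1F)) (W z) ∎)
    where
    k : ℕ
    k = 2+ m

    y : Vector Carrier k
    y i = weight (x i)

    z : Vector Carrier m
    z = tail (tail y)

    factor : ∀ j → Σ-perm k (λ σ → term x σ j) ≈ F′ (x j) * Σ-perm k (λ σ → before (toℕ (σ ⟨$⟩ʳ j)) y σ)
    factor j = trans
      (Σ-perm-cong (λ σ → *-congˡ (Π-filter (λ i → (σ ⟨$⟩ʳ i) <? (σ ⟨$⟩ʳ j)) y id)))
      (Σ-perm-*ˡ k (F′ (x j)) (λ σ → before (toℕ (σ ⟨$⟩ʳ j)) y σ))

  -- The functions F and F′

  11/6*6/11≈1 : 11/6 * 6/11 ≈ 1#
  11/6*6/11≈1 = begin-equality
    11/6 * 6/11                             ≈⟨ *-cong (/≈*inv (fromℕ 11) 6) (/≈*inv (fromℕ 6) 11) ⟩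
    fromℕ 11 * inv 6 * (fromℕ 6 * inv 11)   ≈⟨ solve 4 (λ a b i j → a :* i :* (b :* j) := (a :* j) :* (b :* i))
                                                 refl (fromℕ 11) (fromℕ 6) (inv 6) (inv 11) ⟩
    (fromℕ 11 * inv 11) * (fromℕ 6 * inv 6) ≈⟨ *-cong (fromℕ*inv≈1 11) (fromℕ*inv≈1 6) ⟩
    1# * 1#                                 ≈⟨ *-identityˡ 1# ⟩
    1#                                      ∎

  0≤11/6 : 0# ≤ 11/6
  0≤11/6 = /-nonNeg 6 (0≤fromℕ 11)

  F′-nonNeg : ∀ z → 0# ≤ F′ z
  F′-nonNeg z with does (z ≤? 6/11)
  ... | true  = 0≤11/6
  ... | false = ≤-refl

  weight-nonNeg : ∀ z → 0# ≤ weight z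
  weight-nonNeg z = x≤y⇒0≤y-x (x⊓y≤y (11/6 * z) 1#)

  weight≤1 : ∀ {z} → 0# ≤ z → weight z ≤ 1#
  weight≤1 {z} 0≤z = begin
    1# - F z ≤⟨ +-monoʳ-≤ 1# (neg-anti-≤ (⊓-glb (*-nonNeg 0≤11/6 0≤z) 0≤1)) ⟩
    1# - 0#  ≈⟨ trans (+-congˡ -0#≈0#) (+-identityʳ 1#) ⟩
    1#       ∎

  1≤weight+11/6*z : ∀ z → 1# ≤ weight z + 11/6 * z
  1≤weight+11/6*z z = begin
    1#                  ≈⟨ x-y+y≈x 1# (F z) ⟨
    weight z + F z      ≤⟨ +-monoʳ-≤ (weight z) (x⊓y≤x (11/6 * z) 1#) ⟩
    weight z + 11/6 * z ∎

  weight+11/6*z≈1 : ∀ {z} → z ≤ 6/11 → weight z + 11/6 * z ≈ 1#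
  weight+11/6*z≈1 {z} z≤6/11 = begin-equality
    weight z + 11/6 * z ≈⟨ +-congˡ (x≤y⇒x⊓y≈x (≤-respʳ-≈ 11/6*6/11≈1 (*-monoˡ-≤ 0≤11/6 z≤6/11))) ⟨
    weight z + F z      ≈⟨ x-y+y≈x 1# (F z) ⟩
    1#                  ∎

  weight≈0 : ∀ {z} → 6/11 ≤ z → weight z ≈ 0#
  weight≈0 {z} 6/11≤z = trans
    (+-congˡ (-‿cong (x≤y⇒y⊓x≈x (≤-respˡ-≈ 11/6*6/11≈1 (*-monoˡ-≤ 0≤11/6 6/11≤z)))))
    (-‿inverseʳ 1#)

  sum-weight : ∀ {n} (x : Vector Carrier n) → (∀ i → x i ≤ 6/11) →
               sum (weight ∘ x) + 11/6 * sum x ≈ fromℕ n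
  sum-weight {zero}  x _      = trans (+-identityˡ _) (zeroʳ 11/6)
  sum-weight {suc n} x x≤6/11 = trans
    (solve 5 (λ w W e x X → (w :+ W) :+ e :* (x :+ X) := (w :+ e :* x) :+ (W :+ e :* X)) refl
      (weight (x 0F)) (sum (weight ∘ tail x)) 11/6 (x 0F) (sum (tail x)))
    (+-cong (weight+11/6*z≈1 (x≤6/11 0F)) (sum-weight (tail x) (x≤6/11 ∘ suc)))

  sum-weight≤ : ∀ {n} (x : Vector Carrier n) → (∀ i → x i ≤ 6/11) → ∀ c →
                sum x ≈ fromℕ n * c → sum (weight ∘ x) ≤ fromℕ n * weight c
  sum-weight≤ {n} x x≤6/11 c Σx≈nc = +-cancelʳ-≤ (11/6 * sum x) (begin
    sum (weight ∘ x) + 11/6 * sum x            ≈⟨ sum-weight x x≤6/11 ⟩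
    fromℕ n                                    ≈⟨ *-identityʳ (fromℕ n) ⟨
    fromℕ n * 1#                               ≤⟨ *-monoˡ-≤ (0≤fromℕ n) (1≤weight+11/6*z c) ⟩
    fromℕ n * (weight c + 11/6 * c)            ≈⟨ solve 4 (λ n w e c →
      n :* (w :+ e :* c) := n :* w :+ e :* (n :* c)) refl (fromℕ n) (weight c) 11/6 c ⟩
    fromℕ n * weight c + 11/6 * (fromℕ n * c)  ≈⟨ +-congˡ (*-congˡ Σx≈nc) ⟨
    fromℕ n * weight c + 11/6 * sum x          ∎)

  slope-nonNeg : ∀ x₁ x₂ → 0# ≤ slope x₁ x₂
  slope-nonNeg x₁ x₂ = +-nonNeg (*-nonNeg (F′-nonNeg x₁) (weight-nonNeg x₂))
                                (*-nonNeg (F′-nonNeg x₂) (weight-nonNeg x₁))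

  offset-nonNeg : ∀ x₁ x₂ → 0# ≤ offset x₁ x₂
  offset-nonNeg x₁ x₂ = +-nonNeg (F′-nonNeg x₁) (F′-nonNeg x₂)

  others : ∀ {m} → Vector Carrier (2+ m) → Vector Carrier m
  others x i = x (2 ↑ʳ i)

  d-≤ : ∀ {m n} (x : Vector Carrier (2+ m)) (z : Vector Carrier n) →
        (∀ {α β} → 0# ≤ α → 0# ≤ β →
          fromℕ (2+ n !) * D m α β (W (weight ∘ others x)) ≤
          fromℕ (2+ m !) * D n α β (W (weight ∘ z))) →
        d x ≤ d (x 0F ∷ᵥ x 1F ∷ᵥ z)
  d-≤ {m} {n} x z D≤D = begin
    d x
      ≈⟨ d≈D x ⟩
    (D m α β (W (weight ∘ others x)) / (2+ m !)) {{2+ m ℕ.!≢0}}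
      ≤⟨ /-cross-≤ (2+ m !) (2+ n !) {{2+ m ℕ.!≢0}} {{2+ n ℕ.!≢0}}
           (D≤D (slope-nonNeg (x 0F) (x 1F)) (offset-nonNeg (x 0F) (x 1F))) ⟩
    (D n α β (W (weight ∘ z)) / (2+ n !)) {{2+ n ℕ.!≢0}}
      ≈⟨ d≈D (x 0F ∷ᵥ x 1F ∷ᵥ z) ⟨
    d (x 0F ∷ᵥ x 1F ∷ᵥ z) ∎
    where
    α β : Carrier
    α = slope (x 0F) (x 1F)
    β = offset (x 0F) (x 1F)

  sum-others : ∀ {m} .{{_ : NonZero m}} (x : Vector Carrier (2+ m)) → sum x ≈ 1# →
               sum (others x) ≈ fromℕ m * ((1# - x 0F - x 1F) / m)
  sum-others {m} x Σx≈1 = begin-equality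
    S                                            ≈⟨ x+y-y≈x S (x 1F) ⟨
    (S + x 1F) - x 1F                            ≈⟨ +-congʳ (x+y-y≈x (S + x 1F) (x 0F)) ⟨
    ((S + x 1F) + x 0F) - x 0F - x 1F            ≈⟨ +-congʳ (+-congʳ (solve 3 (λ a b S →
      (S :+ b) :+ a := a :+ (b :+ S)) refl (x 0F) (x 1F) S)) ⟩
    (x 0F + (x 1F + S)) - x 0F - x 1F            ≈⟨ +-congʳ (+-congʳ Σx≈1) ⟩
    1# - x 0F - x 1F                             ≈⟨ fromℕ*[x/n]≈x _ m ⟨
    fromℕ m * ((1# - x 0F - x 1F) / m)           ∎
    where
    S : Carrier
    S = sum (others x)

  d≤C[k] : ∀ m .{{_ : NonZero m}} (x : Vector Carrier (2+ m)) → InSimplex x →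
           (∀ i → x (2 ↑ʳ i) ≤ 6/11) → d x ≤ C[2+ m ] (x 0F) (x 1F)
  d≤C[k] m x (0≤x , Σx≈1) x≤6/11 =
    d-≤ x (replicate m c̄) λ 0≤α 0≤β →
      *-monoˡ-≤ (0≤fromℕ (2+ m !)) (D-mono-≤ 0≤α 0≤β λ p q p+q≡m → ≤-trans
        (W≤n!*c^p (weight ∘ others x) (weight-nonNeg c̄) (weight-nonNeg ∘ others x)
          (sum-weight≤ (others x) x≤6/11 c̄ (sum-others x Σx≈1)) p q p+q≡m)
        (n!*c^p≤W-replicate m (weight-nonNeg c̄) p q p+q≡m))
    where
    c̄ : Carrier
    c̄ = (1# - x 0F - x 1F) / m

  d≤C[3] : ∀ m .{{_ : NonZero m}} (x : Vector Carrier (2+ m)) → InSimplex x →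
           (∃ λ i → 6/11 ≤ x (2 ↑ʳ i)) → d x ≤ C[2+ 1 ] (x 0F) (x 1F)
  d≤C[3] (suc n) x (0≤x , _) (i , 6/11≤xᵢ) =
    d-≤ x (replicate 1 c̄) λ 0≤α 0≤β →
      D-extremal n 0≤α 0≤β (λ _ → weight-nonNeg c̄)
        (W≤n!*q (weight ∘ others x) (weight-nonNeg ∘ others x)
          (λ j → weight≤1 (0≤x (2 ↑ʳ j))) i (weight≈0 6/11≤xᵢ))
    where
    c̄ : Carrier
    c̄ = (1# - x 0F - x 1F) / 1

lemma6p4 : ∀ {c ℓ₁ ℓ₂} (K : OrderedField c ℓ₁ ℓ₂) →
    let open OrderedField K
        open Density K in
    ∀ m .{{_ : NonZero m}} (x : Vector Carrier (2+ m)) → InSimplex x →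
    ((∀ i → x (2 ↑ʳ i) ≤ 6/11) → d x ≤ C[2+ m ] (x 0F) (x 1F)) ×
    ((∃ λ i → 6/11 ≤ x (2 ↑ʳ i)) → d x ≤ C[2+ 1 ] (x 0F) (x 1F))
lemma6p4 K m x x∈Δ = d≤C[k] K m x x∈Δ , d≤C[3] K m x x∈Δ
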